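{- Let $m\ge 1$ be an integer and let $\mathcal{T}=(\tau_1,\dots,\tau_n)$, $\tau_i=(G_i,D_i,T_i)$, be a sporadic DAG task system satisfying: 1. $\mathrm{len}(G_k)\le D_k/3$ for every $k=1,2,\dots,n$; 2. for every $k=1,2,\dots,n$, $$\sum_{i:\,T_i\le D_k}\frac{\mathrm{vol}(G_i)}{T_i}+\sum_{i:\,T_i> D_k}\frac{\mathrm{vol}(G_i)}{D_k}\le \frac{m+1/2}{3}.$$ Then $\mathcal{T}$ is EDF-schedulable on $m$ unit-speed processors.
   Context: $\mathbb{N}$ denotes the positive integers, $\mathbb{N}_0=\mathbb{N}\cup\{0\}$. Sporadic DAG model: a task $\tau_i=(G_i,D_i,T_i)$ consists of a finite directed acyclic graph $G_i=(V_i,E_i)$ whose vertices $v$ (sequential jobs) have processing times $p_v\in\mathbb{N}$, a relative deadline $D_i\in\mathbb{N}$ and a period $T_i\in\mathbb{N}$. A release of a dag-job of $\tau_i$ at time $t\in\mathbb{N}_0$ means that one copy of each job $v\in V_i$ is released at time $t$, and all of these must complete by the absolute deadline $t+D_i$; if $(v,w)\in E_i$, then within the dag-job, job $v$ must complete before job $w$ may begin. Consecutive dag-job releases of $\tau_i$ are at least $T_i$ apart; there are no precedence constraints between different dag-jobs (also if $D_i>T_i$). A task system is a finite collection $\mathcal{T}=(\tau_1,\dots,\tau_n)$ of such tasks; it may generate any (possibly infinite) collection of dag-jobs obtained by letting each task independently release dag-jobs subject to the minimum separation. A chain in $G_i$ is a sequence of vertices $v_1,\dots,v_k$ with $(v_j,v_{j+1})\in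 E_i$ for $1\le j<k$; its length is $\sum_{j=1}^k p_{v_j}$. $\mathrm{len}(G_i)$ is the length of the longest chain in $G_i$, and $\mathrm{vol}(G_i)=\sum_{v\in V_i}p_v$. Schedules: jobs are run on $m$ identical parallel processors of unit speed. Preemption and migration are allowed; at any time a processor runs at most one job and a job runs on at most one processor. A job $j$ is available at time $t$ if it has been released by $t$, all of its predecessors are completed, and $j$ is not yet completed. EDF (Earliest Deadline First): at any time, process the $m$ available jobs with minimum absolute deadline (all available jobs if there are fewer than $m$), ties broken arbitrarily. $\mathcal{T}$ is EDF-schedulable on $m$ unit-speed processors if EDF meets all deadlines on them for every collection of dag-jobs that $\mathcal{T}$ may generate.
   Formalization: Time is rational rather than real: schedules are piecewise constant, and the instants at which the processors' assignment changes (preemptions, migrations, changes in how ties are broken) are rational numbers; task parameters and release times are integers as stated. -}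

module Defs where

open import Data.Bool using (Bool; T; T?; if_then_else_)
open import Data.Fin using (Fin; zero; suc; _≟_)
import Data.Fin as Fin
open import Data.Fin.Properties using (any?; pigeonhole)
open import Data.Integer using (+_)
open import Data.List using (List; []; _∷_; map; filter; sum; foldr; length; lookup;
  allFin; upTo; cartesianProductWith)
open import Data.List.Extrema.Nat using (argmax; argmax-all; f[xs]≤f[argmax])
open import Data.List.Membership.Propositional using (_∈_)
open import Data.List.Membership.Propositional.Properties
  using (∈-allFin; ∈-filter⁺; ∈-cartesianProductWith⁺)
import Data.List.Relation.Unary.All as All
open import Data.List.Relation.Unary.All.Properties using (all-filter)
open import Data.List.Relation.Unary.Any using (here; there)
open import Data.List.Relation.Unary.Linked using (Linked; []; [-]; _∷_; linked?)
open import Data.Maybe using (Maybe; just; nothing)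
import Data.Maybe.Properties as Maybe
open import Data.Nat using (ℕ; zero; suc; NonZero; z≤n; s≤s)
import Data.Nat as ℕ
import Data.Nat.Properties as ℕ
open import Data.Product using (Σ; ∃; _×_; _,_; proj₁; proj₂)
import Data.Product.Properties as Product
open import Data.Rational using (ℚ; 0ℚ; _/_; _+_; _-_; _≤_; _<_; _⊓_)
open import Relation.Binary.Construct.Closure.Transitive using (TransClosure; [_]; _∷_)
open import Relation.Binary.Definitions using (DecidableEquality)
open import Relation.Binary.PropositionalEquality using (_≡_; refl; subst; sym)
open import Relation.Nullary using (¬_; Dec; yes; no; does; contradiction)

fromℕ : ℕ → ℚ
fromℕ n = + n / 1

sumℚ : List ℚ → ℚ
sumℚ = foldr _+_ 0ℚ

record DAG : Set where
  field
    size : ℕ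

  Vertex : Set
  Vertex = Fin size

  field
    edge : Vertex → Vertex → Bool

  Edge : Vertex → Vertex → Set
  Edge v w = T (edge v w)

  field
    acyclic : ∀ v → ¬ TransClosure Edge v v
    p       : Vertex → ℕ
    p-pos   : ∀ v → NonZero (p v)

  -- The empty list is a chain, so that `len` makes sense without vertices.
  Chain : List Vertex → Set
  Chain = Linked Edge

  chain? : ∀ vs → Dec (Chain vs)
  chain? = linked? λ v w → T? (edge v w)

  weight : List Vertex → ℕ
  weight vs = sum (map p vs)

  lists≤ : ℕ → List (List Vertex)
  lists≤ zero    = [] ∷ []
  lists≤ (suc k) = [] ∷ cartesianProductWith _∷_ (allFin size) (lists≤ k)

  -- A chain has distinct vertices, hence at most `size` of them
  -- (see `len-upper`).
  longestChain : List Vertex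
  longestChain = argmax weight [] (filter chain? (lists≤ size))

  len : ℕ
  len = weight longestChain

  vol : ℕ
  vol = sum (map p (allFin size))

module _ (G : DAG) where
  open DAG G

  longestChain-isChain : Chain longestChain
  longestChain-isChain = argmax-all weight {P = Chain} [] (all-filter chain? (lists≤ size))

  private
    lists≤-complete : ∀ k vs → length vs ℕ.≤ k → vs ∈ lists≤ k
    lists≤-complete zero    []       _         = here refl
    lists≤-complete (suc k) []       _         = here refl
    lists≤-complete (suc k) (v ∷ vs) (s≤s l≤k) =
      there (∈-cartesianProductWith⁺ _∷_ (∈-allFin v) (lists≤-complete k vs l≤k))

    path : ∀ {vs} → Chain vs → (i j : Fin (length vs)) → i Fin.< j →
           TransClosure Edge (lookup vs i) (lookup vs j)
    path (e ∷ _)  zero    (suc zero)    _         = [ e ]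
    path (e ∷ es) zero    (suc (suc j)) _         =
      e ∷ path es zero (suc j) (s≤s z≤n)
    path (_ ∷ es) (suc i) (suc j)       (s≤s i<j) = path es i j i<j
    path [-]      zero    (suc ())      _

    chain-length : ∀ vs → Chain vs → length vs ℕ.≤ size
    chain-length vs c with length vs ℕ.≤? size
    ... | yes l≤s = l≤s
    ... | no  l≰s with pigeonhole (ℕ.≰⇒> l≰s) (lookup vs)
    ...   | i , j , i<j , eq =
      contradiction
        (subst (TransClosure Edge (lookup vs i)) (sym eq) (path c i j i<j))
        (acyclic (lookup vs i))

  len-upper : ∀ vs → Chain vs → weight vs ℕ.≤ len
  len-upper vs c = All.lookup (f[xs]≤f[argmax] [] _)
    (∈-filter⁺ chain? (lists≤-complete size vs (chain-length vs c)) c)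

record Task : Set where
  field
    graph        : DAG
    deadline     : ℕ
    period       : ℕ
    deadline-pos : NonZero deadline
    period-pos   : NonZero period

  open DAG graph public

TaskSystem : ℕ → Set
TaskSystem n = Fin n → Task

module _ {n : ℕ} (𝒯 : TaskSystem n) where
  private
    module τ (i : Fin n) = Task (𝒯 i)
  open τ

  private instance
    deadline≢0 : ∀ {i} → NonZero (deadline i)
    deadline≢0 {i} = deadline-pos i

    period≢0 : ∀ {i} → NonZero (period i)
    period≢0 {i} = period-pos i

  density : Fin n → ℚ
  density k =
      sumℚ (map (λ i → + vol i / period i)
                (filter (λ i → period i ℕ.≤? deadline k) (allFin n)))
    + sumℚ (map (λ i → + vol i / deadline k)
                (filter (λ i → period i ℕ.>? deadline k) (allFin n)))

  -- A collection of dag-jobs the system may generate.  As periods are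
  -- positive, a task releases at most one dag-job at a time, so a dag-job is
  -- determined by its task and its release time.
  record Releases : Set where
    field
      released  : Fin n → ℕ → Bool
      separated : ∀ i s t → T (released i s) → T (released i t) →
                  s ℕ.< t → s ℕ.+ period i ℕ.≤ t

  -- (i , r , v) is the copy of vertex v in the dag-job of task i released at r.
  Job : Set
  Job = Σ (Fin n) λ i → ℕ × Vertex i

  _≟ᴶ_ : DecidableEquality Job
  _≟ᴶ_ = Product.≡-dec _≟_ (Product.≡-dec ℕ._≟_ _≟_)

  releaseTime : Job → ℕ
  releaseTime (i , r , v) = r

  absDeadline : Job → ℕ
  absDeadline (i , r , v) = r ℕ.+ deadline i

  processing : Job → ℕ
  processing (i , r , v) = p i v

  -- A piecewise constant preemptive and migratory schedule on m processors:
  -- throughout [time k , time (suc k)) processor c runs the job `assign k c`,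
  -- or idles if this is `nothing`.  The breakpoints are arbitrary rationals.
  record Schedule (m : ℕ) : Set where
    field
      time       : ℕ → ℚ
      start      : time 0 ≡ 0ℚ
      increasing : ∀ k → time k < time (suc k)
      unbounded  : ∀ t → ∃ λ k → t ≤ time k
      assign     : ℕ → Fin m → Maybe Job
      sequential : ∀ k c c′ j → assign k c ≡ just j → assign k c′ ≡ just j → c ≡ c′

    Runs : ℕ → Job → Set
    Runs k j = ∃ λ c → assign k c ≡ just j

    runs? : ∀ k j → Dec (Runs k j)
    runs? k j = any? λ c → Maybe.≡-dec _≟ᴶ_ (assign k c) (just j)

    -- Length of the part of [time k , time (suc k)) lying before t.
    elapsed : ℕ → ℚ → ℚ
    elapsed k t = (time (suc k) ⊓ t) - (time k ⊓ t)

    -- Segments from `unbounded t` on start at t or later.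
    received : Job → ℚ → ℚ
    received j t = sumℚ (map (λ k → if does (runs? k j) then elapsed k t else 0ℚ)
                             (upTo (proj₁ (unbounded t))))

    Completed : Job → ℚ → Set
    Completed j t = fromℕ (processing j) ≤ received j t

  module _ (R : Releases) {m : ℕ} (σ : Schedule m) where
    open Releases R
    open Schedule σ

    record Available (j : Job) (t : ℚ) : Set where
      field
        generated    : T (released (proj₁ j) (releaseTime j))
        arrived      : fromℕ (releaseTime j) ≤ t
        predecessors : let (i , r , v) = j in
                       ∀ u → Edge i u v → Completed (i , r , u) t
        pending      : ¬ Completed j t

    -- At every time, the jobs run are m available ones of minimum absolute
    -- deadline, or all available ones if there are fewer than m; ties may be
    -- broken differently at different times.
    record IsEDF : Set where
      field
        feasible : ∀ k t → time k ≤ t → t < time (suc k) →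
                   ∀ j → Runs k j → Available j t
        greedy   : ∀ k t → time k ≤ t → t < time (suc k) →
                   ∀ j → Available j t → ¬ Runs k j →
                   ∀ c → ∃ λ j′ → assign k c ≡ just j′ ×
                                  absDeadline j′ ℕ.≤ absDeadline j

    MeetsDeadlines : Set
    MeetsDeadlines = ∀ j → T (released (proj₁ j) (releaseTime j)) →
                     Completed j (fromℕ (absDeadline j))

  EDFSchedulable : ℕ → Set
  EDFSchedulable m = ∀ (R : Releases) (σ : Schedule m) → IsEDF R σ → MeetsDeadlines R σ

{-# OPTIONS --safe #-}

-- Consider an earliest missed deadline d, of a dag-job of task i released at
-- r, and the window [r , d] of length D.  Call jobs due by d urgent, and let
-- the slack Y be the time in the window during which not all processors run
-- urgent jobs.  During slack some job on a critical chain of the late dag-job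
-- runs, so Y ≤ len ≤ D/3, and the urgent work done in the window is at least
-- m D - (m - 1) Y ≥ (2m + 1) D / 3.  Dag-jobs due by r are complete at r, so
-- this work belongs to dag-jobs due in (r , d], of which a task with period T
-- has fewer than D/T + 1: at most 2D/T if T ≤ D, and at most one otherwise.
-- Their total volume is at most 2D times the density, i.e. (2m + 1) D / 3, and
-- the late job has not received all of its share: a contradiction.

module Submission where

open import Defs
open import Data.Bool using (T; T?; if_then_else_)
open import Data.Empty using (⊥)
open import Data.Fin using (Fin)
import Data.Fin.Induction as Fin
open import Data.Fin.Properties using (any?; all?)
open import Data.Integer using (+_)
import Data.Integer as ℤ
import Data.Integer.Properties as ℤ
open import Data.List using (List; []; _∷_; _++_; map; filter; length; allFin; upTo; concatMap)
open import Data.List.Membership.Propositional using (_∈_; lose)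
open import Data.List.Membership.Propositional.Properties using (∈-upTo⁻; ∈-upTo⁺; ∈-allFin; ∈-filter⁺; ∈-concatMap⁺; ∈-map⁺)
open import Data.List.Properties using (map-∘; upTo-∷ʳ; filter-++; length-++; length-tabulate)
open import Data.List.Relation.Unary.All using (All; []; _∷_)
open import Data.List.Relation.Unary.AllPairs using ([]; _∷_)
open import Data.List.Relation.Unary.Any using (here; there)
open import Data.List.Relation.Unary.Linked using ([-]; _∷_)
open import Data.List.Relation.Unary.Unique.Propositional using (Unique)
open import Data.List.Relation.Unary.Unique.Propositional.Properties using (allFin⁺)
open import Data.Maybe using (just)
import Data.Maybe.Properties as Maybe
import Data.Maybe.Relation.Unary.Any as Maybe
open import Data.Maybe.Relation.Unary.Any using (just)
open import Data.Nat using (ℕ; zero; suc; _≥_)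
import Data.Nat as ℕ
import Data.Nat.Properties as ℕ
open import Data.Nat.Induction using (<-rec)
open import Data.Nat.ListAction using (sum)
open import Data.Product using (∃; _×_; _,_; proj₁; proj₂)
open import Data.Rational using (ℚ; 0ℚ; 1ℚ; ½; _+_; _-_; _*_; _÷_; _≤_; _<_; _⊓_; _⊔_; _/_; _≤?_; nonNegative; toℚᵘ)
import Data.Rational.Properties as ℚ
open import Data.Rational.Solver using (module +-*-Solver)
open import Data.Rational.Unnormalised using (mkℚᵘ; _≃_; *≡*)
import Data.Rational.Unnormalised as ℚᵘ
import Data.Rational.Unnormalised.Properties as ℚᵘ
open import Data.Sum using (_⊎_; inj₁; inj₂)
open import Function using (_∘_; id)
open import Induction.WellFounded using (WellFounded; Acc; acc)
open import Level using (0ℓ)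
open import Relation.Binary.Construct.Closure.Transitive using (TransClosure; [_]; _∷_)
  renaming (_++_ to _++⁺_)
open import Relation.Binary.PropositionalEquality using (_≡_; _≢_; refl; sym; trans; cong; cong₂; subst; subst₂; isEquivalence; module ≡-Reasoning)
open import Relation.Nullary using (¬_; Dec; yes; no; does; contradiction)
open import Relation.Nullary.Decidable using (¬?; _×-dec_; decidable-stable)
open import Relation.Unary using (Pred; Decidable)

open +-*-Solver using (solve; _:=_; _:+_; _:*_; _:-_; con)

toℚᵘ-fromℕ : ∀ a → toℚᵘ (fromℕ a) ≃ mkℚᵘ (+ a) 0
toℚᵘ-fromℕ a = ℚ.toℚᵘ-fromℚᵘ (mkℚᵘ (+ a) 0)

fromℕ-+ : ∀ a b → fromℕ (a ℕ.+ b) ≡ fromℕ a + fromℕ b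
fromℕ-+ a b = ℚ.toℚᵘ-injective (begin
  toℚᵘ (fromℕ (a ℕ.+ b))              ≈⟨ toℚᵘ-fromℕ (a ℕ.+ b) ⟩
  mkℚᵘ (+ (a ℕ.+ b)) 0                ≈⟨ *≡* (cong (ℤ._* + 1)
    (cong₂ ℤ._+_ (sym (ℤ.*-identityʳ (+ a))) (sym (ℤ.*-identityʳ (+ b))))) ⟩
  mkℚᵘ (+ a) 0 ℚᵘ.+ mkℚᵘ (+ b) 0      ≈⟨ ℚᵘ.+-cong (toℚᵘ-fromℕ a) (toℚᵘ-fromℕ b) ⟨
  toℚᵘ (fromℕ a) ℚᵘ.+ toℚᵘ (fromℕ b)  ≈⟨ ℚ.toℚᵘ-homo-+ (fromℕ a) (fromℕ b) ⟨
  toℚᵘ (fromℕ a + fromℕ b)            ∎)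
  where open ℚᵘ.≃-Reasoning

0≤/ : ∀ a b .{{_ : ℕ.NonZero b}} → 0ℚ ≤ + a / b
0≤/ a b = ℚ.nonNegative⁻¹ _ {{ℚ.normalize-nonNeg a b}}

0≤fromℕ : ∀ a → 0ℚ ≤ fromℕ a
0≤fromℕ a = 0≤/ a 1

fromℕ-mono-≤ : ∀ {a b} → a ℕ.≤ b → fromℕ a ≤ fromℕ b
fromℕ-mono-≤ {a} a≤b with ℕ.m≤n⇒∃[o]m+o≡n a≤b
... | o , refl = begin
  fromℕ a            ≡⟨ ℚ.+-identityʳ _ ⟨
  fromℕ a + 0ℚ       ≤⟨ ℚ.+-monoʳ-≤ (fromℕ a) (0≤fromℕ o) ⟩
  fromℕ a + fromℕ o  ≡⟨ fromℕ-+ a o ⟨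
  fromℕ (a ℕ.+ o)    ∎
  where open ℚ.≤-Reasoning

fromℕ-* : ∀ a b → fromℕ (a ℕ.* b) ≡ fromℕ a * fromℕ b
fromℕ-* zero    b = sym (ℚ.*-zeroˡ (fromℕ b))
fromℕ-* (suc a) b = begin
  fromℕ (b ℕ.+ a ℕ.* b)            ≡⟨ fromℕ-+ b (a ℕ.* b) ⟩
  fromℕ b + fromℕ (a ℕ.* b)        ≡⟨ cong (_+_ (fromℕ b)) (fromℕ-* a b) ⟩
  fromℕ b + fromℕ a * fromℕ b      ≡⟨ solve 2 (λ x y → x :+ y :* x := (con 1ℚ :+ y) :* x) refl (fromℕ b) (fromℕ a) ⟩
  (1ℚ + fromℕ a) * fromℕ b         ≡⟨ cong (_* fromℕ b) (fromℕ-+ 1 a) ⟨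
  fromℕ (suc a) * fromℕ b          ∎
  where open ≡-Reasoning

fromℕ-*-/ : ∀ a b .{{_ : ℕ.NonZero b}} → fromℕ b * (+ a / b) ≡ fromℕ a
fromℕ-*-/ a b@(suc b-1) = ℚ.toℚᵘ-injective (begin
  toℚᵘ (fromℕ b * (+ a / b))          ≈⟨ ℚ.toℚᵘ-homo-* (fromℕ b) (+ a / b) ⟩
  toℚᵘ (fromℕ b) ℚᵘ.* toℚᵘ (+ a / b)  ≈⟨ ℚᵘ.*-cong (toℚᵘ-fromℕ b) (ℚ.toℚᵘ-fromℚᵘ (mkℚᵘ (+ a) b-1)) ⟩
  mkℚᵘ (+ b) 0 ℚᵘ.* mkℚᵘ (+ a) b-1    ≈⟨ *≡* (trans (ℤ.*-identityʳ _)
    (trans (ℤ.*-comm (+ b) (+ a)) (cong (λ x → + a ℤ.* + suc x) (sym (ℕ.+-identityʳ b-1))))) ⟩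
  mkℚᵘ (+ a) 0                        ≈⟨ toℚᵘ-fromℕ a ⟨
  toℚᵘ (fromℕ a)                      ∎)
  where open ℚᵘ.≃-Reasoning

p≤q⇒0≤q-p : ∀ {p q} → p ≤ q → 0ℚ ≤ q - p
p≤q⇒0≤q-p {p} {q} p≤q = subst (_≤ q - p) (ℚ.+-inverseʳ p) (ℚ.+-monoˡ-≤ _ p≤q)

*≤*-/ : ∀ {D} c v x .{{_ : ℕ.NonZero x}} → c ℕ.* x ℕ.≤ D → fromℕ c * fromℕ v ≤ fromℕ D * (+ v / x)
*≤*-/ {D} c v x cx≤D = begin
  fromℕ c * fromℕ v              ≡⟨ cong (fromℕ c *_) (fromℕ-*-/ v x) ⟨
  fromℕ c * (fromℕ x * (+ v / x)) ≡⟨ ℚ.*-assoc (fromℕ c) (fromℕ x) (+ v / x) ⟨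
  fromℕ c * fromℕ x * (+ v / x)  ≡⟨ cong (_* (+ v / x)) (fromℕ-* c x) ⟨
  fromℕ (c ℕ.* x) * (+ v / x)    ≤⟨ ℚ.*-monoʳ-≤-nonNeg (+ v / x) {{nonNegative (0≤/ v x)}} (fromℕ-mono-≤ cx≤D) ⟩
  fromℕ D * (+ v / x)            ∎
  where open ℚ.≤-Reasoning

overload : ∀ {M D Y W A δ} → 1ℚ ≤ M → 0ℚ ≤ D → M * D + Y ≤ M * Y + W → fromℕ 3 * Y ≤ D →
           W < A → A ≤ (D + D) * δ → δ ≤ (M + ½) ÷ fromℕ 3 → ⊥
overload {M} {D} {Y} {W} {A} {δ} 1≤M 0≤D lower 3Y≤D W<A A≤ δ≤ = ℚ.<-irrefl refl (begin-strict
  fromℕ 3 * (M * D + Y)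
    ≤⟨ ℚ.*-monoˡ-≤-nonNeg (fromℕ 3) lower ⟩
  fromℕ 3 * (M * Y + W)
    <⟨ ℚ.*-monoʳ-<-pos (fromℕ 3) (ℚ.+-monoʳ-< (M * Y) (ℚ.<-≤-trans W<A
      (ℚ.≤-trans A≤ (ℚ.*-monoˡ-≤-nonNeg (D + D) {{nonNegative (ℚ.+-mono-≤ 0≤D 0≤D)}} δ≤)))) ⟩
  fromℕ 3 * (M * Y + (D + D) * ((M + ½) ÷ fromℕ 3))
    ≡⟨ solve 3 (λ M D Y → con (fromℕ 3) :* (M :* Y :+ (D :+ D) :* ((M :+ con ½) :* con (+ 1 / 3)))
                       := (M :- con 1ℚ) :* (con (fromℕ 3) :* Y) :+ (con (fromℕ 3) :* Y :+ (D :+ D) :* (M :+ con ½))) refl M D Y ⟩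
  (M - 1ℚ) * (fromℕ 3 * Y) + (fromℕ 3 * Y + (D + D) * (M + ½))
    ≤⟨ ℚ.+-monoˡ-≤ _ (ℚ.*-monoˡ-≤-nonNeg (M - 1ℚ) {{nonNegative (p≤q⇒0≤q-p 1≤M)}} 3Y≤D) ⟩
  (M - 1ℚ) * D + (fromℕ 3 * Y + (D + D) * (M + ½))
    ≡⟨ solve 3 (λ M D Y → (M :- con 1ℚ) :* D :+ (con (fromℕ 3) :* Y :+ (D :+ D) :* (M :+ con ½))
                       := con (fromℕ 3) :* (M :* D :+ Y)) refl M D Y ⟩
  fromℕ 3 * (M * D + Y) ∎)
  where open ℚ.≤-Reasoning

add-difference : ∀ a b c → a + ((b + (c - a)) - b) ≡ c
add-difference = solve 3 (λ a b c → a :+ ((b :+ (c :- a)) :- b) := c) refl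

add-subtract : ∀ a b → (a + b) - b ≡ a
add-subtract = solve 2 (λ a b → (a :+ b) :- b := a) refl

add-subtract-left : ∀ a b → (a + b) - a ≡ b
add-subtract-left = solve 2 (λ a b → (a :+ b) :- a := b) refl

add-subtract-middle : ∀ a b c → (a + (c + b)) - c ≡ a + b
add-subtract-middle = solve 3 (λ a b c → (a :+ (c :+ b)) :- c := a :+ b) refl

+-swapʳ : ∀ a b c → (a + b) + c ≡ (a + c) + b
+-swapʳ = solve 3 (λ a b c → (a :+ b) :+ c := (a :+ c) :+ b) refl

difference-telescope : ∀ a b x y u v → ((a - b) - (x - y)) + ((u - a) - (v - b)) ≡ (u - v) - (x - y)
difference-telescope = solve 6 (λ a b x y u v → ((a :- b) :- (x :- y)) :+ ((u :- a) :- (v :- b)) := (u :- v) :- (x :- y)) refl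

-- The cases of the induction in `critical-chain-suc`: S is the slack so far, w the
-- weight of the chain, ℓ the length of the dag, and x, x′ the work received.
module _ (S w ℓ : ℚ) {x : ℚ} where
  open ℚ.≤-Reasoning

  charge-nothing : ∀ c x′ → S + w ≤ ℓ + x → c ≡ 0ℚ → x ≤ x′ → (S + c) + w ≤ ℓ + x′
  charge-nothing _ x′ bound refl x≤x′ = begin
    (S + 0ℚ) + w  ≡⟨ cong (_+ w) (ℚ.+-identityʳ S) ⟩
    S + w         ≤⟨ bound ⟩
    ℓ + x         ≤⟨ ℚ.+-monoʳ-≤ ℓ x≤x′ ⟩
    ℓ + x′        ∎

  charge-self : ∀ c e x′ → S + w ≤ ℓ + x → c ≤ e → x′ ≡ x + e → (S + c) + w ≤ ℓ + x′
  charge-self c e _ bound c≤e refl = begin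
    (S + c) + w  ≡⟨ +-swapʳ S c w ⟩
    (S + w) + c  ≤⟨ ℚ.+-mono-≤ bound c≤e ⟩
    (ℓ + x) + e  ≡⟨ ℚ.+-assoc ℓ x e ⟩
    ℓ + (x + e)  ∎

  charge-predecessor : ∀ p x′ → S + (p + w) ≤ ℓ + x → x ≤ p → 0ℚ ≤ x′ → S + w ≤ ℓ + x′
  charge-predecessor p x′ bound x≤p 0≤x′ = begin
    S + w              ≡⟨ add-subtract-middle S w p ⟨
    (S + (p + w)) - p  ≤⟨ ℚ.+-monoˡ-≤ _ bound ⟩
    (ℓ + x) - p        ≤⟨ ℚ.+-monoˡ-≤ _ (ℚ.+-monoʳ-≤ ℓ x≤p) ⟩
    (ℓ + p) - p        ≡⟨ trans (add-subtract ℓ p) (sym (ℚ.+-identityʳ ℓ)) ⟩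
    ℓ + 0ℚ             ≤⟨ ℚ.+-monoʳ-≤ ℓ 0≤x′ ⟩
    ℓ + x′             ∎

infix 5 _when_

_when_ : {P : Set} → ℚ → Dec P → ℚ
q when P? = if does P? then q else 0ℚ

module _ {P : Set} {q : ℚ} where

  when-true : (P? : Dec P) → P → (q when P?) ≡ q
  when-true (yes _) _ = refl
  when-true (no ¬p) p = contradiction p ¬p

  when-false : (P? : Dec P) → ¬ P → (q when P?) ≡ 0ℚ
  when-false (yes p) ¬p = contradiction p ¬p
  when-false (no _)  _  = refl

  0≤when : (P? : Dec P) → 0ℚ ≤ q → 0ℚ ≤ (q when P?)
  0≤when (yes _) 0≤q = 0≤q
  0≤when (no _)  _   = ℚ.≤-refl

when-mono-≤ : ∀ {P : Set} (P? : Dec P) {p q} → (P → p ≤ q) → (p when P?) ≤ (q when P?)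
when-mono-≤ (yes x) p≤q = p≤q x
when-mono-≤ (no _)  _   = ℚ.≤-refl

zero-when : ∀ {P : Set} (P? : Dec P) → (0ℚ when P?) ≡ 0ℚ
zero-when (yes _) = refl
zero-when (no _)  = refl

∑ : {A : Set} → List A → (A → ℚ) → ℚ
∑ xs f = sumℚ (map f xs)

module _ {A : Set} where

  ∑-++ : ∀ (f : A → ℚ) xs ys → ∑ (xs ++ ys) f ≡ ∑ xs f + ∑ ys f
  ∑-++ f []       ys = sym (ℚ.+-identityˡ _)
  ∑-++ f (x ∷ xs) ys = trans (cong (_+_ (f x)) (∑-++ f xs ys)) (sym (ℚ.+-assoc (f x) (∑ xs f) (∑ ys f)))

  ∑-cong : ∀ xs {f g : A → ℚ} → (∀ {x} → x ∈ xs → f x ≡ g x) → ∑ xs f ≡ ∑ xs g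
  ∑-cong []       _   = refl
  ∑-cong (x ∷ xs) f≡g = cong₂ _+_ (f≡g (here refl)) (∑-cong xs (f≡g ∘ there))

  ∑-mono-≤ : ∀ xs {f g : A → ℚ} → (∀ {x} → x ∈ xs → f x ≤ g x) → ∑ xs f ≤ ∑ xs g
  ∑-mono-≤ []       _   = ℚ.≤-refl
  ∑-mono-≤ (x ∷ xs) f≤g = ℚ.+-mono-≤ (f≤g (here refl)) (∑-mono-≤ xs (f≤g ∘ there))

  ∑-mono-< : ∀ {xs} {f g : A → ℚ} {x} → (∀ {y} → y ∈ xs → f y ≤ g y) → x ∈ xs → f x < g x → ∑ xs f < ∑ xs g
  ∑-mono-< {xs = _ ∷ xs} f≤g (here refl)  f<g = ℚ.+-mono-<-≤ f<g (∑-mono-≤ xs (f≤g ∘ there))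
  ∑-mono-<               f≤g (there x∈xs) f<g = ℚ.+-mono-≤-< (f≤g (here refl)) (∑-mono-< (f≤g ∘ there) x∈xs f<g)

  0≤∑ : ∀ xs {f : A → ℚ} → (∀ x → 0ℚ ≤ f x) → 0ℚ ≤ ∑ xs f
  0≤∑ []       _   = ℚ.≤-refl
  0≤∑ (x ∷ xs) 0≤f = ℚ.+-mono-≤ (0≤f x) (0≤∑ xs 0≤f)

  ∈⇒≤∑ : ∀ {xs} {f : A → ℚ} {x} → (∀ x → 0ℚ ≤ f x) → x ∈ xs → f x ≤ ∑ xs f
  ∈⇒≤∑ {y ∷ xs} {f} 0≤f (here refl)  = subst (_≤ f y + ∑ xs f) (ℚ.+-identityʳ _) (ℚ.+-monoʳ-≤ (f y) (0≤∑ xs 0≤f))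
  ∈⇒≤∑ {y ∷ xs} {f} 0≤f (there x∈xs) = subst (_≤ f y + ∑ xs f) (ℚ.+-identityˡ _) (ℚ.+-mono-≤ (0≤f y) (∈⇒≤∑ 0≤f x∈xs))

  ∑-zero : ∀ (xs : List A) → ∑ xs (λ _ → 0ℚ) ≡ 0ℚ
  ∑-zero []       = refl
  ∑-zero (_ ∷ xs) = cong (_+_ 0ℚ) (∑-zero xs)

  ∑-+ : ∀ xs (f g : A → ℚ) → ∑ xs (λ x → f x + g x) ≡ ∑ xs f + ∑ xs g
  ∑-+ []       f g = refl
  ∑-+ (x ∷ xs) f g = begin
    (f x + g x) + ∑ xs (λ x → f x + g x)  ≡⟨ cong (_+_ (f x + g x)) (∑-+ xs f g) ⟩
    (f x + g x) + (∑ xs f + ∑ xs g)       ≡⟨ solve 4 (λ a b c d → (a :+ b) :+ (c :+ d) := (a :+ c) :+ (b :+ d)) refl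
                                              (f x) (g x) (∑ xs f) (∑ xs g) ⟩
    (f x + ∑ xs f) + (g x + ∑ xs g)       ∎
    where open ≡-Reasoning

  ∑-*ˡ : ∀ xs q (f : A → ℚ) → ∑ xs (λ x → q * f x) ≡ q * ∑ xs f
  ∑-*ˡ []       q f = sym (ℚ.*-zeroʳ q)
  ∑-*ˡ (x ∷ xs) q f = trans (cong (_+_ (q * f x)) (∑-*ˡ xs q f)) (sym (ℚ.*-distribˡ-+ q (f x) (∑ xs f)))

  ∑-const : ∀ (xs : List A) q → ∑ xs (λ _ → q) ≡ fromℕ (length xs) * q
  ∑-const []       q = sym (ℚ.*-zeroˡ q)
  ∑-const (x ∷ xs) q = begin
    q + ∑ xs (λ _ → q)            ≡⟨ cong (_+_ q) (∑-const xs q) ⟩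
    q + fromℕ (length xs) * q     ≡⟨ solve 2 (λ x y → x :+ y :* x := (con 1ℚ :+ y) :* x) refl q (fromℕ (length xs)) ⟩
    (1ℚ + fromℕ (length xs)) * q  ≡⟨ cong (_* q) (fromℕ-+ 1 (length xs)) ⟨
    fromℕ (suc (length xs)) * q   ∎
    where open ≡-Reasoning

  fromℕ-sum : ∀ xs (f : A → ℕ) → fromℕ (sum (map f xs)) ≡ ∑ xs (fromℕ ∘ f)
  fromℕ-sum []       f = refl
  fromℕ-sum (x ∷ xs) f = trans (fromℕ-+ (f x) (sum (map f xs))) (cong (_+_ (fromℕ (f x))) (fromℕ-sum xs f))

  ∑-unique-≤ : ∀ {xs} {P : Pred A 0ℓ} (P? : Decidable P) {q} → Unique xs → (∀ {x y} → P x → P y → x ≡ y) →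
               0ℚ ≤ q → ∑ xs (λ x → q when P? x) ≤ q
  ∑-unique-≤ P? []        _      0≤q = 0≤q
  ∑-unique-≤ {x ∷ xs} P? {q} (≢s ∷ un) unique 0≤q with P? x
  ... | no _   = subst (_≤ q) (sym (ℚ.+-identityˡ _)) (∑-unique-≤ P? un unique 0≤q)
  ... | yes px = ℚ.≤-reflexive (trans (cong (_+_ q) (rest xs ≢s)) (ℚ.+-identityʳ q))
    where
    rest : ∀ ys → All (x ≢_) ys → ∑ ys (λ y → q when P? y) ≡ 0ℚ
    rest []       []         = refl
    rest (y ∷ ys) (x≢y ∷ ≢s) = cong₂ _+_ (when-false (P? y) (x≢y ∘ unique px)) (rest ys ≢s)

  ∑-filter-≤ : ∀ {P Q : Pred A 0ℓ} (P? : Decidable P) (Q? : Decidable Q) {f g h : A → ℚ} →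
               (∀ {x} → ¬ P x → Q x) → (∀ {x} → P x → ¬ Q x) →
               (∀ {x} → P x → f x ≤ g x) → (∀ {x} → Q x → f x ≤ h x) →
               ∀ xs → ∑ xs f ≤ ∑ (filter P? xs) g + ∑ (filter Q? xs) h
  ∑-filter-≤ P? Q? ¬P⇒Q P⇒¬Q f≤g f≤h []       = ℚ.≤-refl
  ∑-filter-≤ P? Q? {f} {g} {h} ¬P⇒Q P⇒¬Q f≤g f≤h (x ∷ xs) with P? x | Q? x | ∑-filter-≤ P? Q? ¬P⇒Q P⇒¬Q f≤g f≤h xs
  ... | yes p | yes q | _  = contradiction q (P⇒¬Q p)
  ... | no ¬p | no ¬q | _  = contradiction (¬P⇒Q ¬p) ¬q
  ... | yes p | no _  | ih = ℚ.≤-trans (ℚ.+-mono-≤ (f≤g p) ih) (ℚ.≤-reflexive (sym (ℚ.+-assoc (g x) _ _)))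
  ... | no _  | yes q | ih = ℚ.≤-trans (ℚ.+-mono-≤ (f≤h q) ih) (ℚ.≤-reflexive
    (solve 3 (λ a b c → a :+ (b :+ c) := b :+ (a :+ c)) refl (h x) (∑ (filter P? xs) g) (∑ (filter Q? xs) h)))

module _ {A B : Set} where

  ∑-map : ∀ xs (g : A → B) (f : B → ℚ) → ∑ (map g xs) f ≡ ∑ xs (f ∘ g)
  ∑-map xs g f = cong sumℚ (sym (map-∘ xs))

  ∑-concatMap : ∀ xs (g : A → List B) (f : B → ℚ) → ∑ (concatMap g xs) f ≡ ∑ xs (λ x → ∑ (g x) f)
  ∑-concatMap []       g f = refl
  ∑-concatMap (x ∷ xs) g f = trans (∑-++ f (g x) (concatMap g xs)) (cong (_+_ (∑ (g x) f)) (∑-concatMap xs g f))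

  ∑-swap : ∀ xs ys (f : A → B → ℚ) → ∑ xs (λ x → ∑ ys (f x)) ≡ ∑ ys (λ y → ∑ xs (λ x → f x y))
  ∑-swap []       ys f = sym (∑-zero ys)
  ∑-swap (x ∷ xs) ys f = trans (cong (_+_ (∑ ys (f x))) (∑-swap xs ys f)) (sym (∑-+ ys (f x) _))

∑-upTo-suc : ∀ n f → ∑ (upTo (suc n)) f ≡ ∑ (upTo n) f + f n
∑-upTo-suc n f = begin
  ∑ (upTo (suc n)) f           ≡⟨ cong (λ xs → ∑ xs f) (upTo-∷ʳ n) ⟨
  ∑ (upTo n ++ n ∷ []) f       ≡⟨ ∑-++ f (upTo n) (n ∷ []) ⟩
  ∑ (upTo n) f + (f n + 0ℚ)    ≡⟨ cong (_+_ (∑ (upTo n) f)) (ℚ.+-identityʳ (f n)) ⟩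
  ∑ (upTo n) f + f n           ∎
  where open ≡-Reasoning

module _ {P : Pred ℕ 0ℓ} (P? : Decidable P) where

  private
    count : ℕ → ℕ
    count n = length (filter P? (upTo n))

    count-suc : ∀ n → count (suc n) ≡ count n ℕ.+ length (filter P? (n ∷ []))
    count-suc n = begin
      length (filter P? (upTo (suc n)))                   ≡⟨ cong (length ∘ filter P?) (upTo-∷ʳ n) ⟨
      length (filter P? (upTo n ++ n ∷ []))               ≡⟨ cong length (filter-++ P? (upTo n) (n ∷ [])) ⟩
      length (filter P? (upTo n) ++ filter P? (n ∷ []))   ≡⟨ length-++ (filter P? (upTo n)) ⟩
      count n ℕ.+ length (filter P? (n ∷ []))             ∎
      where open ≡-Reasoning

  module _ {gap : ℕ} (separated : ∀ {s t} → P s → P t → s ℕ.< t → s ℕ.+ gap ℕ.≤ t)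
           {lower offset : ℕ} (above : ∀ {s} → P s → lower ℕ.≤ s ℕ.+ offset) where

    private
      count-≤ : ∀ n {s} → P s → n ℕ.≤ s → lower ℕ.+ count n ℕ.* gap ℕ.≤ s ℕ.+ offset
      count-≤ zero    ps _ = subst (ℕ._≤ _) (sym (ℕ.+-identityʳ lower)) (above ps)
      count-≤ (suc n) {s} ps n<s rewrite count-suc n with P? n
      ... | no _   = subst (λ c → lower ℕ.+ c ℕ.* gap ℕ.≤ s ℕ.+ offset) (sym (ℕ.+-identityʳ (count n)))
                           (count-≤ n ps (ℕ.<⇒≤ n<s))
      ... | yes pn = begin
        lower ℕ.+ (count n ℕ.+ 1) ℕ.* gap    ≡⟨ cong (λ c → lower ℕ.+ c ℕ.* gap) (ℕ.+-comm (count n) 1) ⟩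
        lower ℕ.+ (gap ℕ.+ count n ℕ.* gap)  ≡⟨ cong (lower ℕ.+_) (ℕ.+-comm gap _) ⟩
        lower ℕ.+ (count n ℕ.* gap ℕ.+ gap)  ≡⟨ ℕ.+-assoc lower _ gap ⟨
        lower ℕ.+ count n ℕ.* gap ℕ.+ gap    ≤⟨ ℕ.+-monoˡ-≤ gap (count-≤ n pn ℕ.≤-refl) ⟩
        n ℕ.+ offset ℕ.+ gap                 ≡⟨ ℕ.+-assoc n offset gap ⟩
        n ℕ.+ (offset ℕ.+ gap)               ≡⟨ cong (n ℕ.+_) (ℕ.+-comm offset gap) ⟩
        n ℕ.+ (gap ℕ.+ offset)               ≡⟨ ℕ.+-assoc n gap offset ⟨
        n ℕ.+ gap ℕ.+ offset                 ≤⟨ ℕ.+-monoˡ-≤ offset (separated pn ps n<s) ⟩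
        s ℕ.+ offset                         ∎
        where open ℕ.≤-Reasoning

    separated-count-< : ∀ {width} → ℕ.NonZero width → (∀ {s} → P s → s ℕ.+ offset ℕ.< lower ℕ.+ width) →
                        ∀ n → length (filter P? (upTo n)) ℕ.* gap ℕ.< width ℕ.+ gap
    separated-count-< {width} w≢0 below zero = ℕ.≤-trans (ℕ.>-nonZero⁻¹ width {{w≢0}}) (ℕ.m≤m+n width gap)
    separated-count-< {width} w≢0 below (suc n) rewrite count-suc n with P? n
    ... | no _   = subst (λ c → c ℕ.* gap ℕ.< width ℕ.+ gap) (sym (ℕ.+-identityʳ (count n)))
                         (separated-count-< w≢0 below n)
    ... | yes pn = begin-strict
      (count n ℕ.+ 1) ℕ.* gap  ≡⟨ cong (ℕ._* gap) (ℕ.+-comm (count n) 1) ⟩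
      gap ℕ.+ count n ℕ.* gap  ≡⟨ ℕ.+-comm gap _ ⟩
      count n ℕ.* gap ℕ.+ gap  <⟨ ℕ.+-monoˡ-< gap (ℕ.+-cancelˡ-< lower _ _ (ℕ.≤-<-trans (count-≤ n pn ℕ.≤-refl) (below pn))) ⟩
      width ℕ.+ gap            ∎
      where open ℕ.≤-Reasoning

module _ (G : DAG) where
  open DAG G

  edge⁺-wellFounded : WellFounded (TransClosure Edge)
  edge⁺-wellFounded = Fin.spo-wellFounded {_≈_ = _≡_} record
    { isEquivalence = isEquivalence
    ; irrefl        = λ { refl → acyclic _ }
    ; trans         = _++⁺_
    ; <-resp-≈      = (λ { refl e → e }) , (λ { refl e → e })
    }

module _ {n : ℕ} {𝒯 : TaskSystem n} {m : ℕ} (σ : Schedule 𝒯 m) where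
  open Schedule σ

  time-mono-≤ : ∀ {k l} → k ℕ.≤ l → time k ≤ time l
  time-mono-≤ {k} k≤l with ℕ.m≤n⇒∃[o]m+o≡n k≤l
  ... | o , refl = steps o
    where
    steps : ∀ o → time k ≤ time (k ℕ.+ o)
    steps zero    = ℚ.≤-reflexive (cong time (sym (ℕ.+-identityʳ k)))
    steps (suc o) = ℚ.≤-trans (steps o) (subst (λ l → time (k ℕ.+ o) ≤ time l) (sym (ℕ.+-suc k o)) (ℚ.<⇒≤ (increasing _)))

  elapsed-before : ∀ {k t} → t ≤ time k → elapsed k t ≡ 0ℚ
  elapsed-before {k} {t} t≤ = trans
    (cong₂ _-_ (ℚ.p≥q⇒p⊓q≡q (ℚ.≤-trans t≤ (ℚ.<⇒≤ (increasing k)))) (ℚ.p≥q⇒p⊓q≡q t≤))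
    (ℚ.+-inverseʳ t)

  elapsed-after : ∀ {k t} → time (suc k) ≤ t → elapsed k t ≡ time (suc k) - time k
  elapsed-after {k} ≤t = cong₂ _-_ (ℚ.p≤q⇒p⊓q≡p ≤t) (ℚ.p≤q⇒p⊓q≡p (ℚ.≤-trans (ℚ.<⇒≤ (increasing k)) ≤t))

  elapsed-within : ∀ {k t} → time k ≤ t → t ≤ time (suc k) → elapsed k t ≡ t - time k
  elapsed-within k≤t t≤ = cong₂ _-_ (ℚ.p≥q⇒p⊓q≡q t≤) (ℚ.p≤q⇒p⊓q≡p k≤t)

  0≤elapsed : ∀ k t → 0ℚ ≤ elapsed k t
  0≤elapsed k t = p≤q⇒0≤q-p (ℚ.⊓-monoˡ-≤ t (ℚ.<⇒≤ (increasing k)))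

  elapsed-mono-≤ : ∀ k {s t} → s ≤ t → elapsed k s ≤ elapsed k t
  elapsed-mono-≤ k {s} {t} s≤t with ℚ.≤-total s (time k)
  ... | inj₁ s≤k = subst (_≤ elapsed k t) (sym (elapsed-before s≤k)) (0≤elapsed k t)
  ... | inj₂ k≤s = subst (λ x → (time (suc k) ⊓ s) - x ≤ elapsed k t)
    (trans (ℚ.p≤q⇒p⊓q≡p (ℚ.≤-trans k≤s s≤t)) (sym (ℚ.p≤q⇒p⊓q≡p k≤s)))
    (ℚ.+-monoˡ-≤ _ (ℚ.⊓-monoʳ-≤ (time (suc k)) s≤t))

  work : Job 𝒯 → ℕ → ℚ → ℚ
  work j K t = ∑ (upTo K) (λ k → elapsed k t when runs? k j)

  work-suc : ∀ j K t → work j (suc K) t ≡ work j K t + (elapsed K t when runs? K j)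
  work-suc j K t = ∑-upTo-suc K _

  0≤work : ∀ j K t → 0ℚ ≤ work j K t
  0≤work j K t = 0≤∑ (upTo K) (λ k → 0≤when (runs? k j) (0≤elapsed k t))

  work-suc-≤ : ∀ j K t → work j K t ≤ work j (suc K) t
  work-suc-≤ j K t = begin
    work j K t                                ≡⟨ ℚ.+-identityʳ _ ⟨
    work j K t + 0ℚ                           ≤⟨ ℚ.+-monoʳ-≤ (work j K t) (0≤when (runs? K j) (0≤elapsed K t)) ⟩
    work j K t + (elapsed K t when runs? K j) ≡⟨ work-suc j K t ⟨
    work j (suc K) t                          ∎
    where open ℚ.≤-Reasoning

  work-prefix-≤ : ∀ j {K L} → K ℕ.≤ L → ∀ t → work j K t ≤ work j L t
  work-prefix-≤ j {K} K≤L t with ℕ.m≤n⇒∃[o]m+o≡n K≤L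
  ... | o , refl = go o
    where
    go : ∀ o → work j K t ≤ work j (K ℕ.+ o) t
    go zero    = ℚ.≤-reflexive (cong (λ L → work j L t) (sym (ℕ.+-identityʳ K)))
    go (suc o) = ℚ.≤-trans (go o) (subst (λ L → work j (K ℕ.+ o) t ≤ work j L t) (sym (ℕ.+-suc K o)) (work-suc-≤ j (K ℕ.+ o) t))

  work-mono-≤ : ∀ j K {s t} → s ≤ t → work j K s ≤ work j K t
  work-mono-≤ j K s≤t = ∑-mono-≤ (upTo K) (λ {k} _ → when-mono-≤ (runs? k j) (λ _ → elapsed-mono-≤ k s≤t))

  work-past : ∀ j K {s t} → time K ≤ s → time K ≤ t → work j K s ≡ work j K t
  work-past j K K≤s K≤t = ∑-cong (upTo K) (λ {k} k∈ → cong (_when runs? k j)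
    (trans (elapsed-after (ℚ.≤-trans (time-mono-≤ (∈-upTo⁻ k∈)) K≤s))
      (sym (elapsed-after (ℚ.≤-trans (time-mono-≤ (∈-upTo⁻ k∈)) K≤t)))))

  work-idle : ∀ j K {t} → ¬ Runs K j → work j (suc K) t ≡ work j K t
  work-idle j K {t} ¬run = trans (work-suc j K t)
    (trans (cong (_+_ (work j K t)) (when-false (runs? K j) ¬run)) (ℚ.+-identityʳ _))

  work-run : ∀ j K {t} → Runs K j → work j (suc K) t ≡ work j K t + elapsed K t
  work-run j K {t} run = trans (work-suc j K t) (cong (_+_ (work j K t)) (when-true (runs? K j) run))

  work-extend : ∀ j {K L t} → t ≤ time K → K ℕ.≤ L → work j L t ≡ work j K t
  work-extend j {K} {t = t} t≤K K≤L with ℕ.m≤n⇒∃[o]m+o≡n K≤L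
  ... | o , refl = go o
    where
    go : ∀ o → work j (K ℕ.+ o) t ≡ work j K t
    go zero    = cong (λ L → work j L t) (ℕ.+-identityʳ K)
    go (suc o) = begin
      work j (K ℕ.+ suc o) t                                         ≡⟨ cong (λ L → work j L t) (ℕ.+-suc K o) ⟩
      work j (suc (K ℕ.+ o)) t                                       ≡⟨ work-suc j (K ℕ.+ o) t ⟩
      work j (K ℕ.+ o) t + (elapsed (K ℕ.+ o) t when runs? (K ℕ.+ o) j)
        ≡⟨ cong₂ _+_ (go o) (trans (cong (_when runs? (K ℕ.+ o) j) (elapsed-before (ℚ.≤-trans t≤K (time-mono-≤ (ℕ.m≤m+n K o)))))
                                   (zero-when (runs? (K ℕ.+ o) j))) ⟩
      work j K t + 0ℚ                                                ≡⟨ ℚ.+-identityʳ _ ⟩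
      work j K t                                                     ∎
      where open ≡-Reasoning

  work-stable : ∀ j {K L t} → t ≤ time K → t ≤ time L → work j K t ≡ work j L t
  work-stable j {K} {L} t≤K t≤L with ℕ.≤-total K L
  ... | inj₁ K≤L = sym (work-extend j t≤K K≤L)
  ... | inj₂ L≤K = work-extend j t≤L L≤K

  received≡work : ∀ j {K t} → t ≤ time K → received j t ≡ work j K t
  received≡work j {K} {t} t≤K = work-stable j (proj₂ (unbounded t)) t≤K

  received-mono-≤ : ∀ j {s t} → s ≤ t → received j s ≤ received j t
  received-mono-≤ j {s} {t} s≤t = subst (_≤ received j t)
    (sym (received≡work j (ℚ.≤-trans s≤t (proj₂ (unbounded t)))))
    (work-mono-≤ j (proj₁ (unbounded t)) s≤t)

  received-idle : ∀ j {k s t} → time k ≤ s → s ≤ time (suc k) → s ≤ t → ¬ Runs k j → received j s ≡ work j k t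
  received-idle j {k} k≤s s≤k′ s≤t ¬run = trans (received≡work j s≤k′)
    (trans (work-idle j k ¬run) (work-past j k k≤s (ℚ.≤-trans k≤s s≤t)))

  work≤received : ∀ j {k s t} → time k ≤ s → s ≤ time (suc k) → s ≤ t → work j k t ≤ received j s
  work≤received j {k} {s} {t} k≤s s≤k′ s≤t = begin
    work j k t        ≡⟨ work-past j k k≤s (ℚ.≤-trans k≤s s≤t) ⟨
    work j k s        ≤⟨ work-suc-≤ j k s ⟩
    work j (suc k) s  ≡⟨ received≡work j s≤k′ ⟨
    received j s      ∎
    where open ℚ.≤-Reasoning

  module _ {R : Releases 𝒯} (edf : IsEDF 𝒯 R σ) where
    open Releases R
    open IsEDF edf

    private
      P : Job 𝒯 → ℚ
      P j = fromℕ (processing 𝒯 j)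

    -- A job overshooting its processing time within a segment would complete
    -- strictly before the end of that segment while still running.
    work≤processing : ∀ j K t → work j K t ≤ P j
    work≤processing j zero    t = 0≤fromℕ (processing 𝒯 j)
    work≤processing j (suc K) t = step (runs? K j) (t ≤? time K) (work j (suc K) t ≤? P j)
      where
      w : ℚ
      w = work j K t

      step : Dec (Runs K j) → Dec (t ≤ time K) → Dec (work j (suc K) t ≤ P j) → work j (suc K) t ≤ P j
      step _         _         (yes w≤P) = w≤P
      step (no ¬run) _         (no _)    = subst (_≤ P j) (sym (work-idle j K ¬run)) (work≤processing j K t)
      step (yes run) (yes t≤K) (no _)    = subst (_≤ P j)
        (sym (trans (work-run j K run) (trans (cong (_+_ w) (elapsed-before t≤K)) (ℚ.+-identityʳ _))))
        (work≤processing j K t)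
      step (yes run) (no t≰K)  (no w≰P)  = contradiction completed (Available.pending (feasible K s K≤s s<K′ j run))
        where
        s : ℚ
        s = time K + (P j - w)

        K≤t : time K ≤ t
        K≤t = ℚ.<⇒≤ (ℚ.≰⇒> t≰K)

        K≤s : time K ≤ s
        K≤s = subst (_≤ s) (ℚ.+-identityʳ _) (ℚ.+-monoʳ-≤ (time K) (p≤q⇒0≤q-p (work≤processing j K t)))

        s<K′ : s < time (suc K)
        s<K′ = begin-strict
          time K + (P j - w)                        <⟨ ℚ.+-monoʳ-< (time K) (ℚ.+-monoˡ-< _ (ℚ.≰⇒> w≰P)) ⟩
          time K + (work j (suc K) t - w)           ≡⟨ cong (λ x → time K + (x - w)) (work-run j K run) ⟩
          time K + ((w + elapsed K t) - w)
            ≡⟨ cong (λ x → time K + ((w + ((time (suc K) ⊓ t) - x)) - w)) (ℚ.p≤q⇒p⊓q≡p K≤t) ⟩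
          time K + ((w + ((time (suc K) ⊓ t) - time K)) - w)
            ≡⟨ add-difference (time K) w (time (suc K) ⊓ t) ⟩
          time (suc K) ⊓ t                          ≤⟨ ℚ.p⊓q≤p (time (suc K)) t ⟩
          time (suc K)                              ∎
          where open ℚ.≤-Reasoning

        completed : Completed j s
        completed = ℚ.≤-reflexive (sym (begin
          received j s             ≡⟨ received≡work j (ℚ.<⇒≤ s<K′) ⟩
          work j (suc K) s         ≡⟨ work-run j K run ⟩
          work j K s + elapsed K s ≡⟨ cong₂ _+_ (work-past j K K≤s K≤t) (elapsed-within K≤s (ℚ.<⇒≤ s<K′)) ⟩
          w + (s - time K)         ≡⟨ add-difference w (time K) (P j) ⟩
          P j                      ∎))
          where open ≡-Reasoning

    module _ (i : Fin n) (r : ℕ) where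
      private
        module G = Task (𝒯 i)

      d D : ℕ
      d = r ℕ.+ G.deadline
      D = G.deadline

      job : G.Vertex → Job 𝒯
      job v = i , r , v

      -- The length of the part of segment k lying in the window [r , d].
      slice : ℕ → ℚ
      slice k = elapsed k (fromℕ d) - elapsed k (fromℕ r)

      Full : ℕ → Set
      Full k = ∀ c → Maybe.Any (λ j → absDeadline 𝒯 j ℕ.≤ d) (assign k c)

      full? : ∀ k → Dec (Full k)
      full? k = all? λ c → Maybe.dec (λ j → absDeadline 𝒯 j ℕ.≤? d) (assign k c)

      slack : ℕ → ℚ
      slack K = ∑ (upTo K) (λ k → slice k when ¬? (full? k))

      record Moment (k : ℕ) : Set where
        field
          at        : ℚ
          begun     : time k ≤ at
          ongoing   : at < time (suc k)
          released≤ : fromℕ r ≤ at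
          ≤deadline : at ≤ fromℕ d

      r≤d : fromℕ r ≤ fromℕ d
      r≤d = fromℕ-mono-≤ (ℕ.m≤m+n r D)

      0≤slice : ∀ k → 0ℚ ≤ slice k
      0≤slice k = p≤q⇒0≤q-p (elapsed-mono-≤ k r≤d)

      slice≤elapsed : ∀ k → slice k ≤ elapsed k (fromℕ d)
      slice≤elapsed k = begin
        elapsed k (fromℕ d) - elapsed k (fromℕ r)  ≤⟨ ℚ.+-monoʳ-≤ (elapsed k (fromℕ d)) (ℚ.neg-antimono-≤ (0≤elapsed k (fromℕ r))) ⟩
        elapsed k (fromℕ d) + 0ℚ                   ≡⟨ ℚ.+-identityʳ _ ⟩
        elapsed k (fromℕ d)                        ∎
        where open ℚ.≤-Reasoning

      slice-moment : ∀ k → slice k ≡ 0ℚ ⊎ Moment k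
      slice-moment k with fromℕ d ≤? time k | time (suc k) ≤? fromℕ r
      ... | yes d≤k | _ = inj₁ (cong₂ _-_ (elapsed-before d≤k) (elapsed-before (ℚ.≤-trans r≤d d≤k)))
      ... | no _    | yes k′≤r = inj₁ (trans
        (cong₂ _-_ (elapsed-after (ℚ.≤-trans k′≤r r≤d)) (elapsed-after k′≤r))
        (ℚ.+-inverseʳ (time (suc k) - time k)))
      ... | no d≰k  | no k′≰r = inj₂ record
        { at        = time k ⊔ fromℕ r
        ; begun     = ℚ.p≤p⊔q (time k) (fromℕ r)
        ; ongoing   = ongoing
        ; released≤ = ℚ.p≤q⊔p (time k) (fromℕ r)
        ; ≤deadline = ℚ.⊔-lub (ℚ.<⇒≤ (ℚ.≰⇒> d≰k)) r≤d
        }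
        where
        ongoing : time k ⊔ fromℕ r < time (suc k)
        ongoing with ℚ.⊔-sel (time k) (fromℕ r)
        ... | inj₁ eq = subst (_< time (suc k)) (sym eq) (increasing k)
        ... | inj₂ eq = subst (_< time (suc k)) (sym eq) (ℚ.≰⇒> k′≰r)

      ∑-slice : ∀ K → fromℕ d ≤ time K → ∑ (upTo K) slice ≡ fromℕ D
      ∑-slice K d≤K = begin
        ∑ (upTo K) slice
          ≡⟨ telescope K ⟩
        (time K ⊓ fromℕ d - time K ⊓ fromℕ r) - (time 0 ⊓ fromℕ d - time 0 ⊓ fromℕ r)
          ≡⟨ cong₂ _-_ (cong₂ _-_ (ℚ.p≥q⇒p⊓q≡q d≤K) (ℚ.p≥q⇒p⊓q≡q (ℚ.≤-trans r≤d d≤K)))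
                        (cong₂ _-_ (from-start d) (from-start r)) ⟩
        (fromℕ d - fromℕ r) - (0ℚ - 0ℚ)
          ≡⟨ cong (λ x → (x - fromℕ r) - (0ℚ - 0ℚ)) (fromℕ-+ r D) ⟩
        ((fromℕ r + fromℕ D) - fromℕ r) - (0ℚ - 0ℚ)
          ≡⟨ trans (ℚ.+-identityʳ _) (add-subtract-left (fromℕ r) (fromℕ D)) ⟩
        fromℕ D ∎
        where
        open ≡-Reasoning

        from-start : ∀ a → time 0 ⊓ fromℕ a ≡ 0ℚ
        from-start a = trans (ℚ.p≤q⇒p⊓q≡p (subst (_≤ fromℕ a) (sym start) (0≤fromℕ a))) start

        telescope : ∀ K → ∑ (upTo K) slice ≡
                    (time K ⊓ fromℕ d - time K ⊓ fromℕ r) - (time 0 ⊓ fromℕ d - time 0 ⊓ fromℕ r)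
        telescope zero    = sym (ℚ.+-inverseʳ (time 0 ⊓ fromℕ d - time 0 ⊓ fromℕ r))
        telescope (suc K) = trans (∑-upTo-suc K slice) (trans (cong (_+ slice K) (telescope K))
          (difference-telescope
            (time K ⊓ fromℕ d) (time K ⊓ fromℕ r) (time 0 ⊓ fromℕ d) (time 0 ⊓ fromℕ r)
            (time (suc K) ⊓ fromℕ d) (time (suc K) ⊓ fromℕ r)))

      slack-suc : ∀ K → slack (suc K) ≡ slack K + (slice K when ¬? (full? K))
      slack-suc K = ∑-upTo-suc K _

      Done : ℕ → Job 𝒯 → Set
      Done k j = P j ≤ work j k (fromℕ d)

      done? : ∀ k j → Dec (Done k j)
      done? k j = P j ≤? work j k (fromℕ d)

      module _ (generated : T (released i r)) where

        blocked : ∀ {k v} → Moment k → ¬ Done k (job v) → ¬ Runs k (job v) → ¬ Full k →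
                  ∃ λ u → G.Edge u v × ¬ Done k (job u)
        blocked {k} {v} moment ¬done ¬run ¬full = decidable-stable
          (any? λ u → T? (G.edge u v) ×-dec ¬? (done? k (job u)))
          λ unblocked → ¬full λ c →
            let j , eq , j≤d = greedy k at begun ongoing (job v) (available unblocked) ¬run c
            in subst (Maybe.Any _) (sym eq) (just j≤d)
          where
          open Moment moment

          available : ¬ (∃ λ u → G.Edge u v × ¬ Done k (job u)) → Available 𝒯 R σ (job v) at
          available unblocked = record
            { generated    = generated
            ; arrived      = released≤
            ; predecessors = λ u e → ℚ.≤-trans
                (decidable-stable (done? k (job u)) λ ¬done → unblocked (u , e , ¬done))
                (work≤received (job u) begun (ℚ.<⇒≤ ongoing) ≤deadline)
            ; pending      = λ completed → ¬done (ℚ.≤-trans completed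
                (ℚ.≤-reflexive (received-idle (job v) begun (ℚ.<⇒≤ ongoing) ≤deadline ¬run)))
            }

        some-runs : ∀ {k} → Moment k → ¬ Full k → ∀ {v} → Acc (TransClosure G.Edge) v →
                    ¬ Done k (job v) → ∃ λ u → Runs k (job u)
        some-runs {k} moment ¬full {v} (acc rs) ¬done with runs? k (job v)
        ... | yes run = v , run
        ... | no ¬run = let u , e , ¬done′ = blocked moment ¬done ¬run ¬full
                        in some-runs moment ¬full (rs [ e ]) ¬done′

        ¬done-suc : ∀ {k j} → ¬ Done (suc k) j → ¬ Done k j
        ¬done-suc {k} {j} ¬done done = ¬done (ℚ.≤-trans done (work-suc-≤ j k (fromℕ d)))

        private
          Bounded : ℕ → G.Vertex → List G.Vertex → Set
          Bounded K v vs = slack K + fromℕ (G.weight (v ∷ vs)) ≤ fromℕ G.len + work (job v) K (fromℕ d)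

        -- While not all processors are busy with urgent jobs, either v runs or
        -- some unfinished predecessor u of v does, up to the end of u: the
        -- slack is charged to the chain through u, which v ∷ vs prolongs.
        critical-chain : ∀ K {v} vs → G.Chain (v ∷ vs) → ¬ Done K (job v) → Bounded K v vs
        critical-chain-suc : ∀ K {v} → Acc (TransClosure G.Edge) v → ∀ vs → G.Chain (v ∷ vs) →
                             ¬ Done K (job v) → Bounded (suc K) v vs

        critical-chain zero    {v} vs chain _     = subst₂ _≤_ (sym (ℚ.+-identityˡ _)) (sym (ℚ.+-identityʳ _))
          (fromℕ-mono-≤ (len-upper G.graph (v ∷ vs) chain))
        critical-chain (suc K) {v} vs chain ¬done =
          critical-chain-suc K (edge⁺-wellFounded G.graph v) vs chain (¬done-suc {K} {job v} ¬done)

        critical-chain-suc K {v} (acc rs) vs chain ¬done =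
          subst (λ x → x + w ≤ ℓ + w′) (sym (slack-suc K)) (step (slice-moment K) (full? K) (runs? K (job v)))
          where
          w ℓ w′ : ℚ
          w  = fromℕ (G.weight (v ∷ vs))
          ℓ  = fromℕ G.len
          w′ = work (job v) (suc K) (fromℕ d)

          bounded : Bounded K v vs
          bounded = critical-chain K vs chain ¬done

          step : slice K ≡ 0ℚ ⊎ Moment K → (full : Dec (Full K)) → Dec (Runs K (job v)) →
                 (slack K + (slice K when ¬? full)) + w ≤ ℓ + w′
          step (inj₁ empty) full _ = charge-nothing (slack K) w ℓ (slice K when ¬? full) w′ bounded
            (trans (cong (_when ¬? full) empty) (zero-when (¬? full))) (work-suc-≤ (job v) K (fromℕ d))
          step (inj₂ _) (yes _) _ = charge-nothing (slack K) w ℓ 0ℚ w′ bounded refl (work-suc-≤ (job v) K (fromℕ d))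
          step (inj₂ _) (no _) (yes run) =
            charge-self (slack K) w ℓ (slice K) (elapsed K (fromℕ d)) w′ bounded (slice≤elapsed K) (work-run (job v) K run)
          step (inj₂ moment) (no ¬full) (no ¬run) =
            let u , e , ¬done′ = blocked moment ¬done ¬run ¬full
            in charge-predecessor (slack K + slice K) w ℓ (P (job u)) w′
              (subst₂ (λ x y → x + y ≤ ℓ + work (job u) (suc K) (fromℕ d))
                (trans (slack-suc K) (cong (_+_ (slack K)) (when-true (¬? (full? K)) ¬full)))
                (fromℕ-+ (G.p u) (G.weight (v ∷ vs)))
                (critical-chain-suc K (rs [ e ]) (v ∷ vs) (e ∷ chain) ¬done′))
              (work≤processing (job u) (suc K) (fromℕ d)) (0≤work (job v) (suc K) (fromℕ d))

        slack≤len : ∀ K {v} → ¬ Done K (job v) → slack K ≤ fromℕ G.len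
        slack≤len K {v} ¬done = subst₂ _≤_ (ℚ.+-identityʳ (slack K)) (ℚ.+-identityʳ (fromℕ G.len))
          (charge-predecessor (slack K) 0ℚ (fromℕ G.len) (P (job v)) 0ℚ
            (subst (λ x → slack K + x ≤ fromℕ G.len + work (job v) K (fromℕ d)) (fromℕ-+ (G.p v) 0) (critical-chain K [] [-] ¬done))
            (work≤processing (job v) K (fromℕ d)) ℚ.≤-refl)

      DueInWindow : Fin n → ℕ → Set
      DueInWindow a s = T (released a s) × r ℕ.< s ℕ.+ Task.deadline (𝒯 a) × s ℕ.+ Task.deadline (𝒯 a) ℕ.≤ d

      dueInWindow? : ∀ a s → Dec (DueInWindow a s)
      dueInWindow? a s = T? (released a s) ×-dec (r ℕ.<? s ℕ.+ Task.deadline (𝒯 a)) ×-dec (s ℕ.+ Task.deadline (𝒯 a) ℕ.≤? d)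

      windowReleases : Fin n → List ℕ
      windowReleases a = filter (dueInWindow? a) (upTo (suc d))

      dagJob : (a : Fin n) → ℕ → List (Job 𝒯)
      dagJob a s = map (λ v → a , s , v) (allFin (Task.size (𝒯 a)))

      windowJobs : List (Job 𝒯)
      windowJobs = concatMap (λ a → concatMap (dagJob a) (windowReleases a)) (allFin n)

      ∈-windowJobs : ∀ a s v → DueInWindow a s → (a , s , v) ∈ windowJobs
      ∈-windowJobs a s v due = ∈-concatMap⁺ _ (lose (∈-allFin a) (∈-concatMap⁺ _ (lose
        (∈-filter⁺ (dueInWindow? a) (∈-upTo⁺ (ℕ.s≤s (ℕ.≤-trans (ℕ.m≤m+n s _) (proj₂ (proj₂ due))))) due)
        (∈-map⁺ _ (∈-allFin v)))))

      windowReleases-< : ∀ a → length (windowReleases a) ℕ.* Task.period (𝒯 a) ℕ.< D ℕ.+ Task.period (𝒯 a)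
      windowReleases-< a = separated-count-< (dueInWindow? a)
        (λ {s} {t} s-due t-due → separated a s t (proj₁ s-due) (proj₁ t-due))
        (λ s-due → proj₁ (proj₂ s-due))
        G.deadline-pos
        (λ s-due → ℕ.s≤s (proj₂ (proj₂ s-due)))
        (suc d)

      ∑-windowJobs : ∑ windowJobs P ≡ ∑ (allFin n) (λ a → fromℕ (length (windowReleases a)) * fromℕ (Task.vol (𝒯 a)))
      ∑-windowJobs = trans (∑-concatMap (allFin n) _ P) (∑-cong (allFin n) λ {a} _ →
        trans (∑-concatMap (windowReleases a) (dagJob a) P)
        (trans (∑-cong (windowReleases a) λ {s} _ →
                 trans (∑-map (allFin (Task.size (𝒯 a))) (λ v → a , s , v) P) (sym (fromℕ-sum (allFin _) (Task.p (𝒯 a)))))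
               (∑-const (windowReleases a) _)))

      demand≤density : ∑ windowJobs P ≤ fromℕ (D ℕ.+ D) * density 𝒯 i
      demand≤density = begin
        ∑ windowJobs P
          ≡⟨ ∑-windowJobs ⟩
        ∑ (allFin n) (λ a → fromℕ (length (windowReleases a)) * fromℕ (vol a))
          ≤⟨ ∑-filter-≤ (λ a → period a ℕ.≤? D) (λ a → period a ℕ.>? D) ℕ.≰⇒> ℕ.≤⇒≯ (λ {a} → short a) (λ {a} → long a) (allFin n) ⟩
        ∑ shorts (λ a → fromℕ (D ℕ.+ D) * vol/period a) + ∑ longs (λ a → fromℕ (D ℕ.+ D) * vol/D a)
          ≡⟨ cong₂ _+_ (∑-*ˡ shorts (fromℕ (D ℕ.+ D)) vol/period)
                       (∑-*ˡ longs (fromℕ (D ℕ.+ D)) vol/D) ⟩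
        fromℕ (D ℕ.+ D) * ∑ shorts vol/period + fromℕ (D ℕ.+ D) * ∑ longs vol/D
          ≡⟨ ℚ.*-distribˡ-+ (fromℕ (D ℕ.+ D)) (∑ shorts vol/period) (∑ longs vol/D) ⟨
        fromℕ (D ℕ.+ D) * density 𝒯 i ∎
        where
        open ℚ.≤-Reasoning

        instance
          D≢0 : ℕ.NonZero D
          D≢0 = G.deadline-pos

          period≢0 : ∀ {a} → ℕ.NonZero (Task.period (𝒯 a))
          period≢0 {a} = Task.period-pos (𝒯 a)

        vol period : Fin n → ℕ
        vol a    = Task.vol (𝒯 a)
        period a = Task.period (𝒯 a)

        vol/period vol/D : Fin n → ℚ
        vol/period a = + vol a / period a
        vol/D a      = + vol a / D

        shorts longs : List (Fin n)
        shorts = filter (λ a → period a ℕ.≤? D) (allFin n)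
        longs  = filter (λ a → period a ℕ.>? D) (allFin n)

        short : ∀ a → period a ℕ.≤ D → fromℕ (length (windowReleases a)) * fromℕ (vol a) ≤ fromℕ (D ℕ.+ D) * vol/period a
        short a T≤D = *≤*-/ (length (windowReleases a)) (vol a) (period a)
          (ℕ.<⇒≤ (ℕ.<-≤-trans (windowReleases-< a) (ℕ.+-monoʳ-≤ D T≤D)))

        long : ∀ a → period a ℕ.> D → fromℕ (length (windowReleases a)) * fromℕ (vol a) ≤ fromℕ (D ℕ.+ D) * vol/D a
        long a T>D = *≤*-/ (length (windowReleases a)) (vol a) D
          (ℕ.≤-trans (ℕ.*-monoˡ-≤ D at-most-one) (ℕ.+-monoʳ-≤ D ℕ.z≤n))
          where
          at-most-one : length (windowReleases a) ℕ.≤ 1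
          at-most-one = ℕ.s≤s⁻¹ (ℕ.*-cancelʳ-< (period a) (length (windowReleases a)) 2
            (ℕ.<-≤-trans (windowReleases-< a) (ℕ.+-mono-≤ (ℕ.<⇒≤ T>D) (ℕ.m≤m+n (period a) 0))))

      module _ (generated : T (released i r))
               (earlier : ∀ j → T (released (proj₁ j) (releaseTime 𝒯 j)) → absDeadline 𝒯 j ℕ.≤ r →
                          Completed j (fromℕ (absDeadline 𝒯 j))) where

        running∈windowJobs : ∀ {k} → Moment k → ∀ j → Runs k j → absDeadline 𝒯 j ℕ.≤ d → j ∈ windowJobs
        running∈windowJobs {k} moment j@(a , s , v) run j≤d = ∈-windowJobs a s v (j-generated , ℕ.≰⇒> not-due , j≤d)
          where
          open Moment moment

          available : Available 𝒯 R σ j at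
          available = feasible k at begun ongoing j run

          j-generated : T (released a s)
          j-generated = Available.generated available

          not-due : ¬ (absDeadline 𝒯 j ℕ.≤ r)
          not-due due = Available.pending available (ℚ.≤-trans (earlier j j-generated due)
            (received-mono-≤ j (ℚ.≤-trans (fromℕ-mono-≤ due) released≤)))

        private
          segmentWork : ℕ → ℚ
          segmentWork k = ∑ windowJobs (λ j → slice k when runs? k j)

          segmentWork-≥ : ∀ {k} → Moment k → ∀ u → Runs k (job u) → slice k ≤ segmentWork k
          segmentWork-≥ {k} moment u run = subst (_≤ segmentWork k) (when-true (runs? k (job u)) run)
            (∈⇒≤∑ (λ j → 0≤when (runs? k j) (0≤slice k)) (running∈windowJobs moment (job u) run ℕ.≤-refl))

          segmentWork-full : ∀ {k} → Moment k → Full k → fromℕ m * slice k ≤ segmentWork k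
          segmentWork-full {k} moment full = begin
            fromℕ m * slice k
              ≡⟨ cong (λ x → fromℕ x * slice k) (length-tabulate {n = m} id) ⟨
            fromℕ (length (allFin m)) * slice k
              ≡⟨ ∑-const (allFin m) (slice k) ⟨
            ∑ (allFin m) (λ _ → slice k)
              ≤⟨ ∑-mono-≤ (allFin m) (λ {c} _ → busy c (full c) refl) ⟩
            ∑ (allFin m) (λ c → ∑ windowJobs (λ j → slice k when runsOn? c j))
              ≡⟨ ∑-swap (allFin m) windowJobs (λ c j → slice k when runsOn? c j) ⟩
            ∑ windowJobs (λ j → ∑ (allFin m) (λ c → slice k when runsOn? c j))
              ≤⟨ ∑-mono-≤ windowJobs (λ {j} _ → once j (runs? k j)) ⟩
            segmentWork k ∎
            where
            open ℚ.≤-Reasoning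

            runsOn? : ∀ c j → Dec (assign k c ≡ just j)
            runsOn? c j = Maybe.≡-dec (_≟ᴶ_ 𝒯) (assign k c) (just j)

            busy : ∀ c {a} → Maybe.Any (λ j → absDeadline 𝒯 j ℕ.≤ d) a → assign k c ≡ a →
                   slice k ≤ ∑ windowJobs (λ j → slice k when runsOn? c j)
            busy c (just {j} j≤d) eq = ℚ.≤-trans (ℚ.≤-reflexive (sym (when-true (runsOn? c j) eq)))
              (∈⇒≤∑ (λ j → 0≤when (runsOn? c j) (0≤slice k)) (running∈windowJobs moment j (c , eq) j≤d))

            once : ∀ j (run : Dec (Runs k j)) → ∑ (allFin m) (λ c → slice k when runsOn? c j) ≤ (slice k when run)
            once j (yes _)   = ∑-unique-≤ (λ c → runsOn? c j) (allFin⁺ m) (λ {c} {c′} → sequential k c c′ j) (0≤slice k)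
            once j (no ¬run) = ℚ.≤-reflexive (trans
              (∑-cong (allFin m) (λ {c} _ → when-false (runsOn? c j) (λ eq → ¬run (c , eq)))) (∑-zero (allFin m)))

        -- Full segments are worth m processors and the others at least one; the
        -- term (m - 1) * slack is split so that no subtraction occurs.
        progress : ∀ k {v} → ¬ Done k (job v) →
                   fromℕ m * slice k + (slice k when ¬? (full? k)) ≤ fromℕ m * (slice k when ¬? (full? k)) + segmentWork k
        progress k {v} ¬done = step (slice-moment k) (full? k)
          where
          open ℚ.≤-Reasoning

          step : slice k ≡ 0ℚ ⊎ Moment k → (full : Dec (Full k)) →
                 fromℕ m * slice k + (slice k when ¬? full) ≤ fromℕ m * (slice k when ¬? full) + segmentWork k
          step (inj₂ moment) (no ¬full) = ℚ.+-monoʳ-≤ (fromℕ m * slice k)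
            (let u , run = some-runs generated moment ¬full (edge⁺-wellFounded G.graph v) ¬done
             in segmentWork-≥ moment u run)
          step (inj₂ moment) (yes full) = begin
            fromℕ m * slice k + 0ℚ        ≤⟨ ℚ.+-monoˡ-≤ 0ℚ (segmentWork-full moment full) ⟩
            segmentWork k + 0ℚ            ≡⟨ ℚ.+-comm (segmentWork k) 0ℚ ⟩
            0ℚ + segmentWork k            ≡⟨ cong (_+ segmentWork k) (ℚ.*-zeroʳ (fromℕ m)) ⟨
            fromℕ m * 0ℚ + segmentWork k  ∎
          step (inj₁ empty) full = begin
            fromℕ m * slice k + (slice k when ¬? full)
              ≡⟨ cong₂ (λ x y → fromℕ m * x + y) (trans empty (sym slack≡0)) slack≡0 ⟩
            fromℕ m * (slice k when ¬? full) + 0ℚ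
              ≤⟨ ℚ.+-monoʳ-≤ (fromℕ m * (slice k when ¬? full)) (0≤∑ windowJobs (λ j → 0≤when (runs? k j) (0≤slice k))) ⟩
            fromℕ m * (slice k when ¬? full) + segmentWork k ∎
            where
            slack≡0 : (slice k when ¬? full) ≡ 0ℚ
            slack≡0 = trans (cong (_when ¬? full) empty) (zero-when (¬? full))

        module _ {v₀ : G.Vertex} (late : ¬ Completed (job v₀) (fromℕ d)) where

          private
            N : ℕ
            N = proj₁ (unbounded (fromℕ d))

            windowWork : ℚ
            windowWork = ∑ (upTo N) segmentWork

          slack-miss : slack N ≤ fromℕ G.len
          slack-miss = slack≤len generated N {v₀} late

          work<demand : windowWork < ∑ windowJobs P
          work<demand = begin-strict
            windowWork
              ≡⟨ ∑-swap (upTo N) windowJobs (λ k j → slice k when runs? k j) ⟩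
            ∑ windowJobs (λ j → ∑ (upTo N) (λ k → slice k when runs? k j))
              ≤⟨ ∑-mono-≤ windowJobs (λ {j} _ → ∑-mono-≤ (upTo N) (λ {k} _ → when-mono-≤ (runs? k j) (λ _ → slice≤elapsed k))) ⟩
            ∑ windowJobs (λ j → work j N (fromℕ d))
              <⟨ ∑-mono-< (λ {j} _ → work≤processing j N (fromℕ d)) v₀∈ (ℚ.≰⇒> late) ⟩
            ∑ windowJobs P ∎
            where
            open ℚ.≤-Reasoning

            v₀∈ : job v₀ ∈ windowJobs
            v₀∈ = ∈-windowJobs i r v₀ (generated , ℕ.m<m+n r (ℕ.>-nonZero⁻¹ D {{G.deadline-pos}}) , ℕ.≤-refl)

          work-lower : fromℕ m * fromℕ D + slack N ≤ fromℕ m * slack N + windowWork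
          work-lower = begin
            fromℕ m * fromℕ D + slack N
              ≡⟨ cong (λ x → fromℕ m * x + slack N) (∑-slice N (proj₂ (unbounded (fromℕ d)))) ⟨
            fromℕ m * ∑ (upTo N) slice + slack N
              ≡⟨ cong (_+ slack N) (∑-*ˡ (upTo N) (fromℕ m) slice) ⟨
            ∑ (upTo N) (λ k → fromℕ m * slice k) + slack N
              ≡⟨ ∑-+ (upTo N) (λ k → fromℕ m * slice k) idle ⟨
            ∑ (upTo N) (λ k → fromℕ m * slice k + idle k)
              ≤⟨ ∑-mono-≤ (upTo N) (λ {k} k∈ → progress k {v₀} (still-pending (∈-upTo⁻ k∈))) ⟩
            ∑ (upTo N) (λ k → fromℕ m * idle k + segmentWork k)
              ≡⟨ ∑-+ (upTo N) (λ k → fromℕ m * idle k) segmentWork ⟩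
            ∑ (upTo N) (λ k → fromℕ m * idle k) + windowWork
              ≡⟨ cong (_+ windowWork) (∑-*ˡ (upTo N) (fromℕ m) idle) ⟩
            fromℕ m * slack N + windowWork ∎
            where
            open ℚ.≤-Reasoning

            idle : ℕ → ℚ
            idle k = slice k when ¬? (full? k)

            still-pending : ∀ {k} → k ℕ.< N → ¬ Done k (job v₀)
            still-pending {k} k<N done = late (ℚ.≤-trans done (work-prefix-≤ (job v₀) (ℕ.<⇒≤ k<N) (fromℕ d)))

          no-miss : m ≥ 1 → fromℕ G.len ≤ + D / 3 → density 𝒯 i ≤ (fromℕ m + ½) ÷ fromℕ 3 → ⊥
          no-miss m≥1 len≤ density≤ = overload (fromℕ-mono-≤ m≥1) (0≤fromℕ D) work-lower
            (ℚ.≤-trans (ℚ.*-monoˡ-≤-nonNeg (fromℕ 3) (ℚ.≤-trans slack-miss len≤)) (ℚ.≤-reflexive (fromℕ-*-/ D 3)))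
            work<demand
            (subst (λ x → ∑ windowJobs P ≤ x * density 𝒯 i) (fromℕ-+ D D) demand≤density)
            density≤

theorem3 : (m : ℕ) → m ≥ 1 → (n : ℕ) (𝒯 : TaskSystem n) →
    (∀ k → fromℕ (Task.len (𝒯 k)) ≤ + Task.deadline (𝒯 k) / 3) →
    (∀ k → density 𝒯 k ≤ (fromℕ m + ½) ÷ fromℕ 3) →
    EDFSchedulable 𝒯 m
theorem3 m m≥1 n 𝒯 len≤ density≤ R σ edf j gen = <-rec Meets step (absDeadline 𝒯 j) j refl gen
  where
  open Releases R
  open Schedule σ

  Meets : ℕ → Set
  Meets x = ∀ j → absDeadline 𝒯 j ≡ x → T (released (proj₁ j) (releaseTime 𝒯 j)) → Completed j (fromℕ (absDeadline 𝒯 j))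

  step : ∀ x → (∀ {y} → y ℕ.< x → Meets y) → Meets x
  step x earlier j@(i , r , v) refl gen = decidable-stable (_ ≤? _) λ late →
    no-miss σ edf i r gen
      (λ j′ gen′ due → earlier (ℕ.≤-<-trans due (ℕ.m<m+n r (ℕ.>-nonZero⁻¹ _ {{Task.deadline-pos (𝒯 i)}}))) j′ refl gen′)
      late m≥1 (len≤ i) (density≤ i)
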